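{- For any instance of a rule of the sequent calculus $\mathsf{G4KM}$ with premises $s_1,\dots,s_n$ and conclusion $s$, we have $s_i\prec s$ for every $1\le i\le n$.
   Context: Let $\mathsf{Prop}$ be a countably infinite set of propositional variables. Formulas: $\varphi ::= p\in\mathsf{Prop}\mid\bot\mid\varphi\land\varphi\mid\varphi\lor\varphi\mid\varphi\to\varphi\mid\Box\varphi$. $\Gamma,\Delta,\dots$ denote finite multisets of formulas; $\Gamma,\Delta$ denotes multiset sum, and a formula is identified with the singleton multiset. $\Box^{ -1}\Gamma$ is the multiset obtained from $\Gamma$ by replacing each boxed formula $\Box\gamma$ by $\gamma$ (removing one outermost box) and keeping all formulas whose main connective is not $\Box$. A sequent is an expression $\Gamma\Rightarrow\Delta$ with $\Gamma,\Delta$ finite multisets of formulas. The calculus $\mathsf{G4KM}$ has the following rules ($p$ a propositional variable; premises before "/", conclusion after): - ($\bot$L): / $\Gamma,\bot\Rightarrow\Delta$ - (IdP): / $\Gamma,p\Rightarrow p,\Delta$ - ($\land$L): $\Gamma,\varphi,\psi\Rightarrow\Delta$ / $\Gamma,\varphi\land\psi\Rightarrow\Delta$ - ($\land$R): $\Gamma\Rightarrow\varphi,\Delta$ and $\Gamma\Rightarrow\psi,\Delta$ / $\Gamma\Rightarrow\varphi\land\psi,\Delta$ - ($\lor$L): $\Gamma,\varphi\Rightarrow\Delta$ and $\Gamma,\psi\Rightarrow\Delta$ / $\Gamma,\varphi\lor\psi\Rightarrow\Delta$ - ($\lor$R): $\Gamma\Rightarrow\varphi,\psi,\Delta$ / $\Gamma\Rightarrow\varphi\lor\psi,\Delta$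 - ($\land\!\to$L): $\Gamma,\varphi\to(\psi\to\chi)\Rightarrow\Delta$ / $\Gamma,(\varphi\land\psi)\to\chi\Rightarrow\Delta$ - ($\lor\!\to$L): $\Gamma,\varphi\to\chi,\psi\to\chi\Rightarrow\Delta$ / $\Gamma,(\varphi\lor\psi)\to\chi\Rightarrow\Delta$ - ($p\!\to$L): $\Gamma,p,\varphi\Rightarrow\Delta$ / $\Gamma,p,p\to\varphi\Rightarrow\Delta$ - ($\Box$R): $\Box^{ -1}\Gamma,\Box\varphi\Rightarrow\varphi$ / $\Gamma\Rightarrow\Box\varphi,\Delta$ - ($\Box\!\to$L): $\Box^{ -1}\Gamma,\Box\varphi,\psi\Rightarrow\varphi$ and $\Gamma,\psi\Rightarrow\Delta$ / $\Gamma,\Box\varphi\to\psi\Rightarrow\Delta$ - ($\to$R): $\Gamma,\varphi\Rightarrow\psi,\Delta$ and $\Box^{ -1}\Gamma,\varphi\Rightarrow\psi$ / $\Gamma\Rightarrow\varphi\to\psi,\Delta$ - ($\to\!\to$L): $\Gamma,\chi\to\psi,\varphi\Rightarrow\Delta,\chi$ and $\Box^{ -1}\Gamma,\chi\to\psi,\varphi\Rightarrow\chi$ and $\Gamma,\psi\Rightarrow\Delta$ / $\Gamma,(\varphi\to\chi)\to\psi\Rightarrow\Delta$ The weight $w(\varphi)$ of a formula is its size (number of symbols: variables, $\bot$, and connectives, each counted once per occurrence) plus its number of conjunctions; so each conjunction counts $2$ and every other symbol counts $1$. Formulas are (well-founded) ordered by weight: $\varphi$ is smaller than $\psi$ iff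 $w(\varphi)<w(\psi)$. The ordering on sequents is: $(\Gamma\Rightarrow\Delta)\prec(\Gamma'\Rightarrow\Delta')$ iff the multiset $\Gamma,\Delta,\Delta$ is strictly smaller than the multiset $\Gamma',\Delta',\Delta'$ in the Dershowitz–Manna multiset ordering induced by this ordering on formulas. -}

module Defs where

open import Data.List using (List; []; _∷_; _++_; map)
open import Data.List.Relation.Binary.Permutation.Propositional using (_↭_)
open import Data.List.Relation.Binary.Pointwise using (Pointwise)
open import Data.List.Relation.Unary.All using (All)
open import Data.List.Relation.Unary.Any using (Any)
open import Data.Nat using (ℕ; _+_; _<_)
open import Data.Product using (_×_; ∃₂)
open import Level using (Level; _⊔_)
open import Relation.Binary.Core using (Rel)
open import Relation.Binary.PropositionalEquality using (_≢_)

infix  12 □_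
infixr 11 _∧_
infixr 10 _∨_
infixr 9  _⇒_
infix  3  _⊢_
infix  4  _≈_ _≺_ _<ʷ_

data Formula : Set where
  var         : ℕ → Formula
  ⊥           : Formula
  _∧_ _∨_ _⇒_ : Formula → Formula → Formula
  □_          : Formula → Formula

size : Formula → ℕ
size (var p) = 1
size ⊥       = 1
size (φ ∧ ψ) = 1 + size φ + size ψ
size (φ ∨ ψ) = 1 + size φ + size ψ
size (φ ⇒ ψ) = 1 + size φ + size ψ
size (□ φ)   = 1 + size φ

conjunctions : Formula → ℕ
conjunctions (var p) = 0
conjunctions ⊥       = 0
conjunctions (φ ∧ ψ) = 1 + conjunctions φ + conjunctions ψ
conjunctions (φ ∨ ψ) = conjunctions φ + conjunctions ψ
conjunctions (φ ⇒ ψ) = conjunctions φ + conjunctions ψ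
conjunctions (□ φ)   = conjunctions φ

weight : Formula → ℕ
weight φ = size φ + conjunctions φ

_<ʷ_ : Rel Formula _
φ <ʷ ψ = weight φ < weight ψ

-- Finite multisets are represented by lists, with _↭_ as their equality;
-- _++_ is then multiset sum.
Multiset : ∀ {a} → Set a → Set a
Multiset = List

-- The Dershowitz–Manna ordering: M arises from N by removing a nonempty
-- submultiset and adding elements each below some removed one.
record DershowitzManna {a ℓ : Level} {A : Set a} (_⊏_ : Rel A ℓ)
                       (M N : Multiset A) : Set (a ⊔ ℓ) where
  field
    kept removed added : Multiset A
    larger    : N ↭ kept ++ removed
    smaller   : M ↭ kept ++ added
    nonempty  : removed ≢ []
    dominated : All (λ y → Any (λ x → y ⊏ x) removed) added

unbox : Formula → Formula
unbox (□ φ) = φ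
unbox φ     = φ

□⁻¹ : Multiset Formula → Multiset Formula
□⁻¹ = map unbox

record Sequent : Set where
  constructor _⊢_
  field
    antecedent succedent : Multiset Formula

open Sequent public

_≈_ : Rel Sequent _
s ≈ t = (antecedent s ↭ antecedent t) × (succedent s ↭ succedent t)

_≺_ : Rel Sequent _
(Γ ⊢ Δ) ≺ (Γ′ ⊢ Δ′) = DershowitzManna _<ʷ_ (Γ ++ Δ ++ Δ) (Γ′ ++ Δ′ ++ Δ′)

-- The rules on list representatives, with the displayed formulas in front.
data G4KMSchema : List Sequent → Sequent → Set where
  ⊥L  : ∀ {Γ Δ} → G4KMSchema [] (⊥ ∷ Γ ⊢ Δ)
  IdP : ∀ {Γ Δ p} → G4KMSchema [] (var p ∷ Γ ⊢ var p ∷ Δ)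
  ∧L  : ∀ {Γ Δ φ ψ} → G4KMSchema
          ((φ ∷ ψ ∷ Γ ⊢ Δ) ∷ [])
          (φ ∧ ψ ∷ Γ ⊢ Δ)
  ∧R  : ∀ {Γ Δ φ ψ} → G4KMSchema
          ((Γ ⊢ φ ∷ Δ) ∷ (Γ ⊢ ψ ∷ Δ) ∷ [])
          (Γ ⊢ φ ∧ ψ ∷ Δ)
  ∨L  : ∀ {Γ Δ φ ψ} → G4KMSchema
          ((φ ∷ Γ ⊢ Δ) ∷ (ψ ∷ Γ ⊢ Δ) ∷ [])
          (φ ∨ ψ ∷ Γ ⊢ Δ)
  ∨R  : ∀ {Γ Δ φ ψ} → G4KMSchema
          ((Γ ⊢ φ ∷ ψ ∷ Δ) ∷ [])
          (Γ ⊢ φ ∨ ψ ∷ Δ)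
  ∧⇒L : ∀ {Γ Δ φ ψ χ} → G4KMSchema
          (((φ ⇒ (ψ ⇒ χ)) ∷ Γ ⊢ Δ) ∷ [])
          (((φ ∧ ψ) ⇒ χ) ∷ Γ ⊢ Δ)
  ∨⇒L : ∀ {Γ Δ φ ψ χ} → G4KMSchema
          ((φ ⇒ χ ∷ ψ ⇒ χ ∷ Γ ⊢ Δ) ∷ [])
          (((φ ∨ ψ) ⇒ χ) ∷ Γ ⊢ Δ)
  p⇒L : ∀ {Γ Δ p φ} → G4KMSchema
          ((var p ∷ φ ∷ Γ ⊢ Δ) ∷ [])
          (var p ∷ var p ⇒ φ ∷ Γ ⊢ Δ)
  □R  : ∀ {Γ Δ φ} → G4KMSchema
          ((□ φ ∷ □⁻¹ Γ ⊢ φ ∷ []) ∷ [])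
          (Γ ⊢ □ φ ∷ Δ)
  □⇒L : ∀ {Γ Δ φ ψ} → G4KMSchema
          ((□ φ ∷ ψ ∷ □⁻¹ Γ ⊢ φ ∷ []) ∷ (ψ ∷ Γ ⊢ Δ) ∷ [])
          (□ φ ⇒ ψ ∷ Γ ⊢ Δ)
  ⇒R  : ∀ {Γ Δ φ ψ} → G4KMSchema
          ((φ ∷ Γ ⊢ ψ ∷ Δ) ∷ (φ ∷ □⁻¹ Γ ⊢ ψ ∷ []) ∷ [])
          (Γ ⊢ φ ⇒ ψ ∷ Δ)
  ⇒⇒L : ∀ {Γ Δ φ χ ψ} → G4KMSchema
          ((χ ⇒ ψ ∷ φ ∷ Γ ⊢ χ ∷ Δ) ∷
           (χ ⇒ ψ ∷ φ ∷ □⁻¹ Γ ⊢ χ ∷ []) ∷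
           (ψ ∷ Γ ⊢ Δ) ∷ [])
          (((φ ⇒ χ) ⇒ ψ) ∷ Γ ⊢ Δ)

-- Closing under _≈_ makes the rules act on multisets rather than on lists.
G4KMInstance : List Sequent → Sequent → Set
G4KMInstance premises conclusion =
  ∃₂ λ premises′ conclusion′ →
    G4KMSchema premises′ conclusion′
    × Pointwise _≈_ premises′ premises
    × conclusion′ ≈ conclusion

{-# OPTIONS --safe #-}
-- Each premise replaces the principal formula by lighter ones, while every
-- context formula is kept, dropped or replaced by its unboxing, which is no
-- heavier.  The exception is □R, whose premise repeats the principal formula:
-- there the double weighing of succedents is what makes the order decrease.
module Submission where

open import Defs
open import Data.List using (List; []; _∷_; _++_)
open import Data.List.Membership.Propositional using (_∈_; lose)
open import Data.List.Relation.Binary.Permutation.Propositional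
  using (_↭_; ↭-refl; ↭-sym; ↭-trans; prep)
open import Data.List.Relation.Binary.Permutation.Propositional.Properties
  using (++⁺; shift; ++-commutativeMonoid)
open import Data.List.Relation.Binary.Pointwise using (Pointwise; []; _∷_)
import Data.List.Relation.Binary.Sublist.Heterogeneous as Sublist
open Sublist using (Sublist; []; _∷_; _∷ʳ_)
import Data.List.Relation.Binary.Sublist.Heterogeneous.Properties as Sublistₚ
open import Data.List.Relation.Unary.All as All using (All; []; _∷_)
open import Data.List.Relation.Unary.Any using (here; there)
open import Data.List.Relation.Unary.Any.Properties using (¬Any[])
open import Data.Nat using (_+_; s≤s)
open import Data.Nat.Properties
  using (≤-refl; ≤-reflexive; <-trans; m≤n⇒m≤1+n; m≤m+n; m≤n+m; +-monoˡ-<)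
open import Data.Nat.Tactic.RingSolver using (solve-∀)
open import Data.Product using (_,_)
open import Level using (Level)
open import Relation.Binary.Construct.Closure.Reflexive using (ReflClosure; refl; [_])
open import Relation.Binary.Core using (Rel)
open import Relation.Binary.PropositionalEquality as ≡ using (_≡_)

private variable
  a ℓ : Level

-- Closure properties of the Dershowitz-Manna ordering.

module _ {A : Set a} {_⊏_ : Rel A ℓ} where

  private
    _<ᴰᴹ_ = DershowitzManna _⊏_

  DM-resp-↭ : ∀ {M M′ N N′} → M ↭ M′ → N ↭ N′ → M <ᴰᴹ N → M′ <ᴰᴹ N′
  DM-resp-↭ M↭M′ N↭N′ M<N = record
    { DershowitzManna M<N
    ; larger  = ↭-trans (↭-sym N↭N′) (DershowitzManna.larger M<N)
    ; smaller = ↭-trans (↭-sym M↭M′) (DershowitzManna.smaller M<N)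
    }

  -- Nothing is kept: all of `N` is removed and all of `M` added, so the single element `x` bounds
  -- every addition.
  DM-dominated : ∀ {M N x} → x ∈ N → All (_⊏ x) M → M <ᴰᴹ N
  DM-dominated {M} {N} x∈N M⊏x = record
    { kept      = []
    ; removed   = N
    ; added     = M
    ; larger    = ↭-refl
    ; smaller   = ↭-refl
    ; nonempty  = λ { ≡.refl → ¬Any[] x∈N }
    ; dominated = All.map (lose x∈N) M⊏x
    }

  -- By induction on the sublist: a skipped element joins `removed`, an equal one joins `kept`, and
  -- a strictly lighter one is exchanged. The strict decrease comes from `M <ᴰᴹ N`.
  DM-++ˡ : ∀ {M N M′ N′} → Sublist (ReflClosure _⊏_) M′ N′ →
           M <ᴰᴹ N → (M′ ++ M) <ᴰᴹ (N′ ++ N)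
  DM-++ˡ [] M<N = M<N
  DM-++ˡ (x ∷ʳ M′≤N′) M<N = record
    { kept      = kept
    ; removed   = x ∷ removed
    ; added     = added
    ; larger    = ↭-trans (prep x larger) (↭-sym (shift x kept removed))
    ; smaller   = smaller
    ; nonempty  = λ ()
    ; dominated = All.map there dominated
    }
    where open DershowitzManna (DM-++ˡ M′≤N′ M<N)
  DM-++ˡ (_∷_ {x} refl M′≤N′) M<N = record
    { kept      = x ∷ kept
    ; removed   = removed
    ; added     = added
    ; larger    = prep x larger
    ; smaller   = prep x smaller
    ; nonempty  = nonempty
    ; dominated = dominated
    }
    where open DershowitzManna (DM-++ˡ M′≤N′ M<N)
  DM-++ˡ (_∷_ {y} {_} {x} [ y⊏x ] M′≤N′) M<N = record
    { kept      = kept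
    ; removed   = x ∷ removed
    ; added     = y ∷ added
    ; larger    = ↭-trans (prep x larger) (↭-sym (shift x kept removed))
    ; smaller   = ↭-trans (prep y smaller) (↭-sym (shift y kept added))
    ; nonempty  = λ ()
    ; dominated = here y⊏x ∷ All.map there dominated
    }
    where open DershowitzManna (DM-++ˡ M′≤N′ M<N)

-- Weights of compound formulas.

weight-∧ : ∀ φ ψ → weight (φ ∧ ψ) ≡ 2 + (weight φ + weight ψ)
weight-∧ φ ψ = lemma (size φ) (size ψ) (conjunctions φ) (conjunctions ψ)
  where
  lemma : ∀ s t c d → (1 + s + t) + (1 + c + d) ≡ 2 + ((s + c) + (t + d))
  lemma = solve-∀

weight-∨ : ∀ φ ψ → weight (φ ∨ ψ) ≡ 1 + (weight φ + weight ψ)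
weight-∨ φ ψ = lemma (size φ) (size ψ) (conjunctions φ) (conjunctions ψ)
  where
  lemma : ∀ s t c d → (1 + s + t) + (c + d) ≡ 1 + ((s + c) + (t + d))
  lemma = solve-∀

weight-⇒ : ∀ φ ψ → weight (φ ⇒ ψ) ≡ 1 + (weight φ + weight ψ)
-- `size` and `conjunctions` have the same clauses for both connectives, so the two statements agree
-- definitionally.
weight-⇒ = weight-∨

φ<φ∧ψ : ∀ φ ψ → φ <ʷ φ ∧ ψ
φ<φ∧ψ φ ψ rewrite weight-∧ φ ψ = m≤n⇒m≤1+n (s≤s (m≤m+n (weight φ) _))

ψ<φ∧ψ : ∀ φ ψ → ψ <ʷ φ ∧ ψ
ψ<φ∧ψ φ ψ rewrite weight-∧ φ ψ = m≤n⇒m≤1+n (s≤s (m≤n+m _ (weight φ)))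

φ<φ∨ψ : ∀ φ ψ → φ <ʷ φ ∨ ψ
φ<φ∨ψ φ ψ rewrite weight-∨ φ ψ = s≤s (m≤m+n (weight φ) _)

ψ<φ∨ψ : ∀ φ ψ → ψ <ʷ φ ∨ ψ
ψ<φ∨ψ φ ψ rewrite weight-∨ φ ψ = s≤s (m≤n+m _ (weight φ))

φ<φ⇒ψ : ∀ φ ψ → φ <ʷ φ ⇒ ψ
φ<φ⇒ψ φ ψ rewrite weight-⇒ φ ψ = s≤s (m≤m+n (weight φ) _)

ψ<φ⇒ψ : ∀ φ ψ → ψ <ʷ φ ⇒ ψ
ψ<φ⇒ψ φ ψ rewrite weight-⇒ φ ψ = s≤s (m≤n+m _ (weight φ))

φ<□φ : ∀ φ → φ <ʷ □ φ
φ<□φ φ = ≤-refl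

⇒-monoˡ-<ʷ : ∀ φ ψ χ → φ <ʷ ψ → (φ ⇒ χ) <ʷ (ψ ⇒ χ)
⇒-monoˡ-<ʷ φ ψ χ φ<ψ rewrite weight-⇒ φ χ | weight-⇒ ψ χ =
  s≤s (+-monoˡ-< (weight χ) φ<ψ)

-- This is the only place where the extra weight of a conjunction is needed.
curry-<ʷ : ∀ φ ψ χ → (φ ⇒ (ψ ⇒ χ)) <ʷ ((φ ∧ ψ) ⇒ χ)
curry-<ʷ φ ψ χ = ≤-reflexive
  (lemma (size φ) (size ψ) (size χ)
         (conjunctions φ) (conjunctions ψ) (conjunctions χ))
  where
  lemma : ∀ s t u c d e → 1 + ((1 + s + (1 + t + u)) + (c + (d + e)))
                        ≡ (1 + (1 + s + t) + u) + ((1 + c + d) + e)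
  lemma = solve-∀

-- Active parts and contexts of sequents.

infix 4 _≤ᴹ_

_≤ᴹ_ : Rel (Multiset Formula) _
_≤ᴹ_ = Sublist (ReflClosure _<ʷ_)

≤ᴹ-refl : ∀ {Γ} → Γ ≤ᴹ Γ
≤ᴹ-refl = Sublistₚ.refl refl

unbox-≤ : ∀ φ → ReflClosure _<ʷ_ (unbox φ) φ
unbox-≤ (var _) = refl
unbox-≤ ⊥       = refl
unbox-≤ (_ ∧ _) = refl
unbox-≤ (_ ∨ _) = refl
unbox-≤ (_ ⇒ _) = refl
unbox-≤ (□ φ)   = [ φ<□φ φ ]

□⁻¹-≤ᴹ : ∀ Γ → □⁻¹ Γ ≤ᴹ Γ
□⁻¹-≤ᴹ []      = []
□⁻¹-≤ᴹ (φ ∷ Γ) = unbox-≤ φ ∷ □⁻¹-≤ᴹ Γ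

weighed : Sequent → Multiset Formula
weighed (Γ ⊢ Δ) = Γ ++ Δ ++ Δ

weighed-resp-≈ : ∀ {s t} → s ≈ t → weighed s ↭ weighed t
weighed-resp-≈ (Γ↭Γ′ , Δ↭Δ′) = ++⁺ Γ↭Γ′ (++⁺ Δ↭Δ′ Δ↭Δ′)

≺-resp-≈ : ∀ {s s′ t t′} → s ≈ s′ → t ≈ t′ → s ≺ t → s′ ≺ t′
≺-resp-≈ s≈s′ t≈t′ = DM-resp-↭ (weighed-resp-≈ s≈s′) (weighed-resp-≈ t≈t′)

infixl 5 _+ˢ_

-- Separates an active part from its context: with literal lists on the left, the sum computes to
-- the sequent displayed in a rule.
_+ˢ_ : Sequent → Sequent → Sequent
(Γ ⊢ Δ) +ˢ (Γ′ ⊢ Δ′) = (Γ ++ Γ′) ⊢ (Δ ++ Δ′)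

-- The summands are swapped on the left so that the context `t` comes first, as `DM-++ˡ` expects.
weighed-+ˢ : ∀ s t → weighed t ++ weighed s ↭ weighed (s +ˢ t)
weighed-+ˢ (Γ ⊢ Δ) (Γ′ ⊢ Δ′) =
  solve 4 (λ Γ Δ Γ′ Δ′ →
      (Γ′ ⊕ (Δ′ ⊕ Δ′)) ⊕ (Γ ⊕ (Δ ⊕ Δ)) ⊜ (Γ ⊕ Γ′) ⊕ ((Δ ⊕ Δ′) ⊕ (Δ ⊕ Δ′)))
    ↭-refl Γ Δ Γ′ Δ′
  where open import Algebra.Solver.CommutativeMonoid ++-commutativeMonoid

≺-+ˢ : ∀ s t c c′ → s ≺ t → weighed c ≤ᴹ weighed c′ → s +ˢ c ≺ t +ˢ c′
≺-+ˢ s t c c′ s≺t c≤c′ =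
  DM-resp-↭ (weighed-+ˢ s c) (weighed-+ˢ t c′) (DM-++ˡ c≤c′ s≺t)

local-≺ : ∀ s t Γ Δ → s ≺ t → s +ˢ (Γ ⊢ Δ) ≺ t +ˢ (Γ ⊢ Δ)
local-≺ s t Γ Δ s≺t = ≺-+ˢ s t (Γ ⊢ Δ) (Γ ⊢ Δ) s≺t ≤ᴹ-refl

modal-≺ : ∀ s t Γ Δ → s ≺ t → s +ˢ (□⁻¹ Γ ⊢ []) ≺ t +ˢ (Γ ⊢ Δ)
modal-≺ s t Γ Δ s≺t = ≺-+ˢ s t (□⁻¹ Γ ⊢ []) (Γ ⊢ Δ) s≺t
  -- The context of the premise weighs `□⁻¹ Γ ++ []`; its trailing `[]` lies below `Δ ++ Δ`, which
  -- is dropped.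
  (Sublistₚ.++⁺ (□⁻¹-≤ᴹ Γ) (Sublist.minimum (Δ ++ Δ)))

-- The decrease, rule by rule.

schema-≺ : ∀ {premises conclusion} → G4KMSchema premises conclusion →
           All (_≺ conclusion) premises
schema-≺ ⊥L  = []
schema-≺ IdP = []
schema-≺ (∧L {Γ} {Δ} {φ} {ψ}) =
  local-≺ (φ ∷ ψ ∷ [] ⊢ []) (φ ∧ ψ ∷ [] ⊢ []) Γ Δ
    (DM-dominated (here ≡.refl) (φ<φ∧ψ φ ψ ∷ ψ<φ∧ψ φ ψ ∷ [])) ∷ []
schema-≺ (∧R {Γ} {Δ} {φ} {ψ}) =
  local-≺ ([] ⊢ φ ∷ []) ([] ⊢ φ ∧ ψ ∷ []) Γ Δ
    -- The bound appears twice because succedent formulas are weighed twice.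
    (DM-dominated (here ≡.refl) (φ<φ∧ψ φ ψ ∷ φ<φ∧ψ φ ψ ∷ [])) ∷
  local-≺ ([] ⊢ ψ ∷ []) ([] ⊢ φ ∧ ψ ∷ []) Γ Δ
    (DM-dominated (here ≡.refl) (ψ<φ∧ψ φ ψ ∷ ψ<φ∧ψ φ ψ ∷ [])) ∷ []
schema-≺ (∨L {Γ} {Δ} {φ} {ψ}) =
  local-≺ (φ ∷ [] ⊢ []) (φ ∨ ψ ∷ [] ⊢ []) Γ Δ
    (DM-dominated (here ≡.refl) (φ<φ∨ψ φ ψ ∷ [])) ∷
  local-≺ (ψ ∷ [] ⊢ []) (φ ∨ ψ ∷ [] ⊢ []) Γ Δ
    (DM-dominated (here ≡.refl) (ψ<φ∨ψ φ ψ ∷ [])) ∷ []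
schema-≺ (∨R {Γ} {Δ} {φ} {ψ}) =
  local-≺ ([] ⊢ φ ∷ ψ ∷ []) ([] ⊢ φ ∨ ψ ∷ []) Γ Δ
    (DM-dominated (here ≡.refl)
      (φ<φ∨ψ φ ψ ∷ ψ<φ∨ψ φ ψ ∷ φ<φ∨ψ φ ψ ∷ ψ<φ∨ψ φ ψ ∷ [])) ∷ []
schema-≺ (∧⇒L {Γ} {Δ} {φ} {ψ} {χ}) =
  local-≺ (φ ⇒ (ψ ⇒ χ) ∷ [] ⊢ []) ((φ ∧ ψ) ⇒ χ ∷ [] ⊢ []) Γ Δ
    (DM-dominated (here ≡.refl) (curry-<ʷ φ ψ χ ∷ [])) ∷ []
schema-≺ (∨⇒L {Γ} {Δ} {φ} {ψ} {χ}) =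
  local-≺ (φ ⇒ χ ∷ ψ ⇒ χ ∷ [] ⊢ []) ((φ ∨ ψ) ⇒ χ ∷ [] ⊢ []) Γ Δ
    (DM-dominated (here ≡.refl)
      (⇒-monoˡ-<ʷ φ (φ ∨ ψ) χ (φ<φ∨ψ φ ψ) ∷
       ⇒-monoˡ-<ʷ ψ (φ ∨ ψ) χ (ψ<φ∨ψ φ ψ) ∷ [])) ∷ []
-- The kept variable is itself lighter than p ⇒ φ, so it may count as replaced.
schema-≺ (p⇒L {Γ} {Δ} {p} {φ}) =
  local-≺ (var p ∷ φ ∷ [] ⊢ []) (var p ∷ var p ⇒ φ ∷ [] ⊢ []) Γ Δ
    (DM-dominated (there (here ≡.refl))
      (φ<φ⇒ψ (var p) φ ∷ ψ<φ⇒ψ (var p) φ ∷ [])) ∷ []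
schema-≺ (□R {Γ} {Δ} {φ}) =
  modal-≺ (□ φ ∷ [] ⊢ φ ∷ []) ([] ⊢ □ φ ∷ []) Γ Δ
    -- The active parts weigh `□ φ, φ, φ` against `□ φ, □ φ`: one `□ φ` is kept on both sides, and
    -- the other dominates both copies of `φ`.
    (DM-++ˡ {M′ = □ φ ∷ []} {N′ = □ φ ∷ []} ≤ᴹ-refl
      (DM-dominated (here ≡.refl) (φ<□φ φ ∷ φ<□φ φ ∷ []))) ∷ []
schema-≺ (□⇒L {Γ} {Δ} {φ} {ψ}) =
  modal-≺ (□ φ ∷ ψ ∷ [] ⊢ φ ∷ []) (□ φ ⇒ ψ ∷ [] ⊢ []) Γ Δ
    (DM-dominated (here ≡.refl)
      (φ<φ⇒ψ (□ φ) ψ ∷ ψ<φ⇒ψ (□ φ) ψ ∷ φ< ∷ φ< ∷ [])) ∷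
  local-≺ (ψ ∷ [] ⊢ []) (□ φ ⇒ ψ ∷ [] ⊢ []) Γ Δ
    (DM-dominated (here ≡.refl) (ψ<φ⇒ψ (□ φ) ψ ∷ [])) ∷ []
  where
  φ< : φ <ʷ (□ φ ⇒ ψ)
  φ< = <-trans (φ<□φ φ) (φ<φ⇒ψ (□ φ) ψ)
schema-≺ (⇒R {Γ} {Δ} {φ} {ψ}) =
  local-≺ (φ ∷ [] ⊢ ψ ∷ []) ([] ⊢ φ ⇒ ψ ∷ []) Γ Δ active ∷
  modal-≺ (φ ∷ [] ⊢ ψ ∷ []) ([] ⊢ φ ⇒ ψ ∷ []) Γ Δ active ∷ []
  where
  -- Both premises have this active part; they differ only in their contexts.
  active : (φ ∷ [] ⊢ ψ ∷ []) ≺ ([] ⊢ φ ⇒ ψ ∷ [])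
  active = DM-dominated (here ≡.refl)
    (φ<φ⇒ψ φ ψ ∷ ψ<φ⇒ψ φ ψ ∷ ψ<φ⇒ψ φ ψ ∷ [])
schema-≺ (⇒⇒L {Γ} {Δ} {φ} {χ} {ψ}) =
  local-≺ (χ ⇒ ψ ∷ φ ∷ [] ⊢ χ ∷ []) ((φ ⇒ χ) ⇒ ψ ∷ [] ⊢ []) Γ Δ active ∷
  modal-≺ (χ ⇒ ψ ∷ φ ∷ [] ⊢ χ ∷ []) ((φ ⇒ χ) ⇒ ψ ∷ [] ⊢ []) Γ Δ active ∷
  local-≺ (ψ ∷ [] ⊢ []) ((φ ⇒ χ) ⇒ ψ ∷ [] ⊢ []) Γ Δ
    (DM-dominated (here ≡.refl) (ψ<φ⇒ψ (φ ⇒ χ) ψ ∷ [])) ∷ []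
  where
  φ< : φ <ʷ ((φ ⇒ χ) ⇒ ψ)
  φ< = <-trans (φ<φ⇒ψ φ χ) (φ<φ⇒ψ (φ ⇒ χ) ψ)
  χ< : χ <ʷ ((φ ⇒ χ) ⇒ ψ)
  χ< = <-trans (ψ<φ⇒ψ φ χ) (φ<φ⇒ψ (φ ⇒ χ) ψ)
  active : (χ ⇒ ψ ∷ φ ∷ [] ⊢ χ ∷ []) ≺ ((φ ⇒ χ) ⇒ ψ ∷ [] ⊢ [])
  active = DM-dominated (here ≡.refl)
    -- `χ ⇒ ψ` is lighter because its antecedent `χ` is lighter than `φ ⇒ χ`.
    (⇒-monoˡ-<ʷ χ (φ ⇒ χ) ψ (ψ<φ⇒ψ φ χ) ∷ φ< ∷ χ< ∷ χ< ∷ [])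

-- From list representatives to multisets.

All-≺-resp-≈ : ∀ {premises premises′ s t} → Pointwise _≈_ premises premises′ →
               s ≈ t → All (_≺ s) premises → All (_≺ t) premises′
All-≺-resp-≈ []              s≈t []          = []
All-≺-resp-≈ (p≈p′ ∷ ps≈ps′) s≈t (p≺s ∷ ps≺s) =
  ≺-resp-≈ p≈p′ s≈t p≺s ∷ All-≺-resp-≈ ps≈ps′ s≈t ps≺s

proposition1 : (premises : List Sequent) (conclusion : Sequent) →
    G4KMInstance premises conclusion →
    All (λ premise → premise ≺ conclusion) premises
proposition1 premises conclusion (_ , _ , rule , premises≈ , conclusion≈) =
  All-≺-resp-≈ premises≈ conclusion≈ (schema-≺ rule)
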